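{- Let $(X,c)$ be a finite metric space with $n$ points and let $1\le k\le n$. For every execution of the Reverse Greedy algorithm (with arbitrary tie-breaking), the set $R_k$ it produces satisfies $$\mathrm{cost}(R_k) \;\le\; 2H_{n-k}\cdot \min_{F\subseteq X,\ |F|=k}\mathrm{cost}(F),$$ where $H_m = \sum_{i=1}^m 1/i$ is the $m$-th harmonic number ($H_0=0$). In particular, the approximation ratio of Reverse Greedy for the metric $k$-median problem is $O(\log n)$.
   Context: For $x\in X$ and nonempty $F\subseteq X$, $c_{xF}=\min_{f\in F}c_{xf}$, and $\mathrm{cost}(F)=\sum_{x\in X} c_{xF}$. The Reverse Greedy algorithm on an $n$-point space $X$: set $R_n = X$; for $t = n, n-1,\dots,2$, set $R_{t-1} = R_t\setminus\{r_t\}$ where $r_t\in R_t$ is chosen (ties broken arbitrarily) to minimize $\mathrm{cost}(R_{t-1})$. -}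

module Defs where

open import Level using (Level; _⊔_) renaming (suc to lsuc)
open import Algebra.Bundles using (CommutativeRing)
import Algebra.Definitions.RawMonoid as RawMonoidDefs
import Data.List.Extrema as Extrema
open import Data.Fin using (Fin; toℕ)
open import Data.Fin.Subset using (Subset; inside; outside; _∈_; ⊤; _-_; ∣_∣)
open import Data.Fin.Subset.Properties using (_∈?_)
open import Data.List using (List; []; _∷_; [_]; _++_; map; filter; allFin)
open import Data.Nat as ℕ using (ℕ; zero; suc; pred)
open import Data.Nat.Logarithm using (⌊log₂_⌋)
open import Data.Product using (∃; ∃-syntax; _×_)
open import Data.Vec using (_∷_; [])
open import Function.Metric.Structures using (IsGeneralMetric)
open import Relation.Binary using (Rel; IsTotalOrder; TotalOrder)
open import Relation.Binary.PropositionalEquality using (_≡_)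
open import Relation.Nullary using (¬_)

private
  variable
    c ℓ₁ ℓ₂ : Level

-- Distances take values in an arbitrary (totally) ordered field; the
-- real numbers are the instance of interest.
record OrderedField c ℓ₁ ℓ₂ : Set (lsuc (c ⊔ ℓ₁ ⊔ ℓ₂)) where
  infix  4 _≤_
  infix  8 _⁻¹
  field
    commutativeRing : CommutativeRing c ℓ₁
  open CommutativeRing commutativeRing public
  field
    _≤_          : Rel Carrier ℓ₂
    isTotalOrder : IsTotalOrder _≈_ _≤_
    +-monoʳ-≤    : ∀ x {y z} → y ≤ z → x + y ≤ x + z
    *-nonNeg     : ∀ {x y} → 0# ≤ x → 0# ≤ y → 0# ≤ x * y
    0≉1          : ¬ (0# ≈ 1#)
    -- The value of 0# ⁻¹ is unconstrained.
    _⁻¹          : Carrier → Carrier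
    *-inverseʳ   : ∀ x → ¬ (x ≈ 0#) → x * x ⁻¹ ≈ 1#

  totalOrder : TotalOrder c ℓ₁ ℓ₂
  totalOrder = record { isTotalOrder = isTotalOrder }

  open RawMonoidDefs +-rawMonoid public using (sum)

  fromℕ : ℕ → Carrier
  fromℕ n = RawMonoidDefs._×_ +-rawMonoid n 1#

  -- H m = 1/1 + 1/2 + ⋯ + 1/m
  H : ℕ → Carrier
  H m = sum {m} (λ i → fromℕ (suc (toℕ i)) ⁻¹)

  -- The value at [] is a dummy: below, minimum is only of interest for
  -- the distance to a nonempty set and for the family of k-subsets of an
  -- n-point space with 1 ≤ k ≤ n.
  minimum : List Carrier → Carrier
  minimum []       = 0#
  minimum (y ∷ ys) = Extrema.min totalOrder y ys

  -- f(n) = O(g(n)) as n → ∞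
  _=O_ : (ℕ → Carrier) → (ℕ → ℕ) → Set ℓ₂
  f =O g = ∃[ C ] ∃[ N ] (∀ n → N ℕ.≤ n → f n ≤ fromℕ C * fromℕ (g n))

record FiniteMetricSpace (K : OrderedField c ℓ₁ ℓ₂) (n : ℕ) : Set (c ⊔ ℓ₁ ⊔ ℓ₂) where
  open OrderedField K
  field
    dist     : Fin n → Fin n → Carrier
    isMetric : IsGeneralMetric _≡_ _≈_ _≤_ 0# _+_ dist

elements : ∀ {n} → Subset n → List (Fin n)
elements {n} F = filter (_∈? F) (allFin n)

subsets : ∀ n → List (Subset n)
subsets zero    = [ [] ]
subsets (suc n) = map (outside ∷_) (subsets n) ++ map (inside ∷_) (subsets n)

subsetsOfSize : ∀ n → ℕ → List (Subset n)
subsetsOfSize n k = filter (λ F → ∣ F ∣ ℕ.≟ k) (subsets n)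

module _ {K : OrderedField c ℓ₁ ℓ₂} {n : ℕ} (X : FiniteMetricSpace K n) where
  open OrderedField K hiding (_-_)
  open FiniteMetricSpace X

  distTo : Fin n → Subset n → Carrier
  distTo x F = minimum (map (dist x) (elements F))

  cost : Subset n → Carrier
  cost F = sum (λ x → distTo x F)

  optimalCost : ℕ → Carrier
  optimalCost k = minimum (map cost (subsetsOfSize n k))

  -- r is a possible choice of the point to remove from R (ties arbitrary).
  GreedyChoice : Subset n → Fin n → Set ℓ₂
  GreedyChoice R r = r ∈ R × (∀ s → s ∈ R → cost (R - r) ≤ cost (R - s))

  -- Only the values R t with 1 ≤ t ≤ n are meaningful.
  record Execution : Set ℓ₂ where
    field
      R     : ℕ → Subset n
      start : R n ≡ ⊤
      step  : ∀ t → 2 ℕ.≤ t → t ℕ.≤ n →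
              ∃[ r ] GreedyChoice (R t) r × R (pred t) ≡ R t - r

-- ρ(n) bounds the approximation ratio of Reverse Greedy for metric
-- k-median on all n-point instances.
HasApproximationRatio : (K : OrderedField c ℓ₁ ℓ₂) →
                        (ℕ → OrderedField.Carrier K) → Set (c ⊔ ℓ₁ ⊔ ℓ₂)
HasApproximationRatio K ρ =
  ∀ n (X : FiniteMetricSpace K n) k → 1 ℕ.≤ k → k ℕ.≤ n →
  (E : Execution X) → cost X (Execution.R E k) ≤ ρ n * optimalCost X k
  where open OrderedField K

-- O(log n). The floored binary logarithm stands in for log: for n ≥ 2 we have
-- ⌊log₂ n⌋ ≤ log₂ n ≤ 2 ⌊log₂ n⌋, so both define the same O-class.
IsOLog : (K : OrderedField c ℓ₁ ℓ₂) → (ℕ → OrderedField.Carrier K) → Set ℓ₂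
IsOLog K ρ = ρ =O ⌊log₂_⌋
  where open OrderedField K

{-# OPTIONS --safe #-}
module Submission where

-- Let M be an optimal k-set and R the current set of Reverse Greedy, |R| = k + j
-- with j ≥ 1. Sending each m ∈ M to its nearest point of R gives Q ⊆ R with
-- |Q| ≤ k, and two triangle inequalities show that every x has a point of Q within
-- 2 d(x,M) + d(x,R). Deleting r ∈ R ∖ Q changes d(x,R) only when r is the point of R
-- nearest to x, and then x can move to its point of Q; so the increases caused by
-- the deletions of the single points r ∈ R ∖ Q add up to at most 2 cost(M). There
-- are at least j of them, so the greedy deletion costs at most 2 cost(M) / j.
-- Summing over j = 1, …, n - k gives the harmonic number, and halving n gives
-- H n ≤ 1 + ⌊log₂ n⌋.

open import Defs
open import Level using (Level)
open import Data.Nat as ℕ using (ℕ; zero; suc; _∸_; z≤n; s≤s; ⌊_/2⌋; ⌈_/2⌉)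
import Data.Nat.Properties as ℕ
open import Data.Nat.Induction using (<-rec)
open import Data.Nat.Logarithm using (⌊log₂_⌋; ⌊log₂⌋-mono-≤; ⌊log₂⌊n/2⌋⌋≡⌊log₂n⌋∸1; ⌊log₂[2^n]⌋≡n)
open import Data.Bool.Base using (true; false; if_then_else_)
open import Data.Fin.Base using (Fin; zero; suc; toℕ)
open import Data.Fin.Properties using (toℕ-fromℕ; toℕ-inject₁)
open import Data.Fin.Subset using 
  (Subset; inside; outside; _∈_; _∉_; _⊆_; _∪_; _─_; _-_; ⊥; ⊤; ⁅_⁆; ∣_∣; Nonempty)
open import Data.Fin.Subset.Properties
  using (_∈?_; nonempty?; Empty-unique; ∣⊥∣≡0; ∣⊤∣≡n; ∈⊤; x∈⁅x⁆; x∈⁅y⁆⇒x≡y; ∣⁅x⁆∣≡1; ∉⊥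
        ; x∈p∪q⁺; x∈p∪q⁻; p─q⊆p; x∈p∧x≢y⇒x∈p-y; x∈p⇒∣p-x∣<∣p∣)
open import Data.List.Base using (_∷_; map; allFin)
import Data.List.Extrema as Extrema
open import Data.List.Membership.Propositional using () renaming (_∈_ to _∈ˡ_)
open import Data.List.Membership.Propositional.Properties
  using (∈-map⁺; ∈-map⁻; ∈-filter⁺; ∈-filter⁻; ∈-allFin; ∈-++⁺ˡ; ∈-++⁺ʳ)
import Data.List.Relation.Unary.All as All
open import Data.List.Relation.Unary.Any using (here; there)
open import Data.Product using (∃-syntax; _×_; _,_; proj₁; proj₂)
open import Data.Sum using (inj₁; inj₂)
open import Data.Vec.Base using ([]; _∷_; lookup; here; there)
open import Data.Vec.Properties using (lookup⇒[]=)
open import Function.Base using (_∘_)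
open import Function.Metric.Structures using (IsGeneralMetric)
open import Relation.Binary using (IsTotalOrder; TotalOrder)
open import Relation.Binary.PropositionalEquality as ≡ using (_≡_; _≢_)
open import Relation.Nullary using (¬_; yes; no; contradiction)
import Algebra.Properties.CommutativeMonoid.Sum as SumProperties
import Algebra.Properties.Semiring.Sum as SemiringSum
import Algebra.Properties.Semiring.Mult as Mult
import Algebra.Properties.Ring as RingProperties
import Relation.Binary.Reasoning.PartialOrder as PartialOrderReasoning

private
  variable
    c ℓ₁ ℓ₂ : Level

-- Finite subsets

0<∣p∣⇒Nonempty : ∀ {n} {p : Subset n} → 0 ℕ.< ∣ p ∣ → Nonempty p
0<∣p∣⇒Nonempty {n} {p} 0<∣p∣ with nonempty? p
... | yes ne = ne
... | no  ¬ne = contradiction (≡.trans (≡.cong ∣_∣ (Empty-unique ¬ne)) (∣⊥∣≡0 n)) (ℕ.m<n⇒n≢0 0<∣p∣)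

∣p∪q∣≤∣p∣+∣q∣ : ∀ {n} (p q : Subset n) → ∣ p ∪ q ∣ ℕ.≤ ∣ p ∣ ℕ.+ ∣ q ∣
∣p∪q∣≤∣p∣+∣q∣ []            []            = z≤n
∣p∪q∣≤∣p∣+∣q∣ (outside ∷ p) (outside ∷ q) = ∣p∪q∣≤∣p∣+∣q∣ p q
∣p∪q∣≤∣p∣+∣q∣ (outside ∷ p) (inside  ∷ q) =
  ℕ.≤-trans (s≤s (∣p∪q∣≤∣p∣+∣q∣ p q)) (ℕ.≤-reflexive (≡.sym (ℕ.+-suc ∣ p ∣ ∣ q ∣)))
∣p∪q∣≤∣p∣+∣q∣ (inside  ∷ p) (outside ∷ q) = s≤s (∣p∪q∣≤∣p∣+∣q∣ p q)
∣p∪q∣≤∣p∣+∣q∣ (inside  ∷ p) (inside  ∷ q) =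
  s≤s (ℕ.≤-trans (∣p∪q∣≤∣p∣+∣q∣ p q) (ℕ.+-monoʳ-≤ ∣ p ∣ (ℕ.n≤1+n ∣ q ∣)))

-- Serves twice: for the exact size after a one-point deletion, and for the number of points of R
-- outside Q.
∣p∣≤∣p─q∣+∣q∣ : ∀ {n} (p q : Subset n) → ∣ p ∣ ℕ.≤ ∣ p ─ q ∣ ℕ.+ ∣ q ∣
∣p∣≤∣p─q∣+∣q∣ []            []            = z≤n
∣p∣≤∣p─q∣+∣q∣ (outside ∷ p) (outside ∷ q) = ∣p∣≤∣p─q∣+∣q∣ p q
∣p∣≤∣p─q∣+∣q∣ (outside ∷ p) (inside  ∷ q) =
  ℕ.≤-trans (∣p∣≤∣p─q∣+∣q∣ p q) (ℕ.+-monoʳ-≤ ∣ p ─ q ∣ (ℕ.n≤1+n ∣ q ∣))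
∣p∣≤∣p─q∣+∣q∣ (inside  ∷ p) (outside ∷ q) = s≤s (∣p∣≤∣p─q∣+∣q∣ p q)
∣p∣≤∣p─q∣+∣q∣ (inside  ∷ p) (inside  ∷ q) =
  ℕ.≤-trans (s≤s (∣p∣≤∣p─q∣+∣q∣ p q)) (ℕ.≤-reflexive (≡.sym (ℕ.+-suc ∣ p ─ q ∣ ∣ q ∣)))

x∈p⇒1+∣p-x∣≡∣p∣ : ∀ {n} {p : Subset n} {x} → x ∈ p → suc ∣ p - x ∣ ≡ ∣ p ∣
x∈p⇒1+∣p-x∣≡∣p∣ {p = p} {x} x∈p = ℕ.≤-antisym (x∈p⇒∣p-x∣<∣p∣ x∈p) (begin
  ∣ p ∣                      ≤⟨ ∣p∣≤∣p─q∣+∣q∣ p ⁅ x ⁆ ⟩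
  ∣ p - x ∣ ℕ.+ ∣ ⁅ x ⁆ ∣    ≡⟨ ≡.cong (∣ p - x ∣ ℕ.+_) (∣⁅x⁆∣≡1 x) ⟩
  ∣ p - x ∣ ℕ.+ 1            ≡⟨ ℕ.+-comm ∣ p - x ∣ 1 ⟩
  suc ∣ p - x ∣              ∎)
  where open ℕ.≤-Reasoning

x∈p─q⇒x∉q : ∀ {n} (p q : Subset n) {x} → x ∈ p ─ q → x ∉ q
x∈p─q⇒x∉q (_ ∷ p) (outside ∷ q) (there x∈p─q) (there x∈q) = x∈p─q⇒x∉q p q x∈p─q x∈q
x∈p─q⇒x∉q (_ ∷ p) (inside  ∷ q) (there x∈p─q) (there x∈q) = x∈p─q⇒x∉q p q x∈p─q x∈q

-- Recursion along the bit vector lets the cardinality bound follow from subadditivity of the union.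
image : ∀ {m n} → (Fin m → Fin n) → Subset m → Subset n
image f []            = ⊥
image f (outside ∷ p) = image (f ∘ suc) p
image f (inside  ∷ p) = ⁅ f zero ⁆ ∪ image (f ∘ suc) p

∣image∣≤∣p∣ : ∀ {m n} (f : Fin m → Fin n) p → ∣ image f p ∣ ℕ.≤ ∣ p ∣
∣image∣≤∣p∣ {n = n} f [] = ℕ.≤-reflexive (∣⊥∣≡0 n)
∣image∣≤∣p∣ f (outside ∷ p) = ∣image∣≤∣p∣ (f ∘ suc) p
∣image∣≤∣p∣ f (inside  ∷ p) = ℕ.≤-trans (∣p∪q∣≤∣p∣+∣q∣ ⁅ f zero ⁆ _)
  (ℕ.+-mono-≤ (ℕ.≤-reflexive (∣⁅x⁆∣≡1 (f zero))) (∣image∣≤∣p∣ (f ∘ suc) p))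

∈-image⁺ : ∀ {m n} (f : Fin m → Fin n) {p x} → x ∈ p → f x ∈ image f p
∈-image⁺ f {inside  ∷ p} here        = x∈p∪q⁺ (inj₁ (x∈⁅x⁆ (f zero)))
∈-image⁺ f {outside ∷ p} (there x∈p) = ∈-image⁺ (f ∘ suc) x∈p
∈-image⁺ f {inside  ∷ p} (there x∈p) = x∈p∪q⁺ (inj₂ (∈-image⁺ (f ∘ suc) x∈p))

image-⊆ : ∀ {m n} (f : Fin m → Fin n) p {q} → (∀ i → f i ∈ q) → image f p ⊆ q
image-⊆ f []            f∈q x∈ = contradiction x∈ ∉⊥
image-⊆ f (outside ∷ p) f∈q x∈ = image-⊆ (f ∘ suc) p (f∈q ∘ suc) x∈
image-⊆ f (inside  ∷ p) {q} f∈q x∈ with x∈p∪q⁻ ⁅ f zero ⁆ _ x∈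
... | inj₁ x∈⁅f0⁆  = ≡.subst (_∈ q) (≡.sym (x∈⁅y⁆⇒x≡y _ x∈⁅f0⁆)) (f∈q zero)
... | inj₂ x∈image = image-⊆ (f ∘ suc) p (f∈q ∘ suc) x∈image

∈-elements⁺ : ∀ {n} {F : Subset n} {x} → x ∈ F → x ∈ˡ elements F
∈-elements⁺ {F = F} x∈F = ∈-filter⁺ (_∈? F) (∈-allFin _) x∈F

∈-elements⁻ : ∀ {n} {F : Subset n} {x} → x ∈ˡ elements F → x ∈ F
∈-elements⁻ {n} {F} x∈ = proj₂ (∈-filter⁻ (_∈? F) {xs = allFin n} x∈)

∈-subsets : ∀ {n} (F : Subset n) → F ∈ˡ subsets n
∈-subsets []                    = here ≡.refl
∈-subsets         (outside ∷ F) = ∈-++⁺ˡ (∈-map⁺ (outside ∷_) (∈-subsets F))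
∈-subsets {suc n} (inside  ∷ F) =
  ∈-++⁺ʳ (map (outside ∷_) (subsets n)) (∈-map⁺ (inside ∷_) (∈-subsets F))

-- Order and arithmetic in an ordered field

module OrderedFieldProperties (K : OrderedField c ℓ₁ ℓ₂) where
  open OrderedField K hiding (_-_; zero)
  open RingProperties ring using (-‿distribˡ-*; -‿involutive)
  open IsTotalOrder isTotalOrder public using ()
    renaming (total to ≤-total; trans to ≤-trans; refl to ≤-refl; reflexive to ≤-reflexive; antisym to ≤-antisym)
  open SumProperties +-commutativeMonoid using (sum-cong-≋; sum-init-last; sum-replicate-zero)
  open Mult semiring using (×1-homo-*)
  open PartialOrderReasoning (TotalOrder.poset totalOrder)

  +-monoˡ-≤ : ∀ x {y z} → y ≤ z → y + x ≤ z + x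
  +-monoˡ-≤ x {y} {z} y≤z = begin
    y + x  ≈⟨ +-comm y x ⟩
    x + y  ≤⟨ +-monoʳ-≤ x y≤z ⟩
    x + z  ≈⟨ +-comm x z ⟩
    z + x  ∎

  +-mono-≤ : ∀ {w x y z} → w ≤ x → y ≤ z → w + y ≤ x + z
  +-mono-≤ {x = x} {y} w≤x y≤z = ≤-trans (+-monoˡ-≤ y w≤x) (+-monoʳ-≤ x y≤z)

  x≤x+y : ∀ x {y} → 0# ≤ y → x ≤ x + y
  x≤x+y x {y} 0≤y = begin
    x       ≈⟨ +-identityʳ x ⟨
    x + 0#  ≤⟨ +-monoʳ-≤ x 0≤y ⟩
    x + y   ∎

  +-nonNeg : ∀ {x y} → 0# ≤ x → 0# ≤ y → 0# ≤ x + y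
  +-nonNeg {x} 0≤x 0≤y = ≤-trans 0≤x (x≤x+y x 0≤y)

  x+y-x≈y : ∀ x y → x + y + - x ≈ y
  x+y-x≈y x y = begin-equality
    x + y + - x    ≈⟨ +-congʳ (+-comm x y) ⟩
    y + x + - x    ≈⟨ +-assoc y x (- x) ⟩
    y + (x + - x)  ≈⟨ +-congˡ (-‿inverseʳ x) ⟩
    y + 0#         ≈⟨ +-identityʳ y ⟩
    y              ∎

  x+[y-x]≈y : ∀ x y → x + (y + - x) ≈ y
  x+[y-x]≈y x y = trans (sym (+-assoc x y (- x))) (x+y-x≈y x y)

  y≤x+z⇒y-x≤z : ∀ {x y z} → y ≤ x + z → y + - x ≤ z
  y≤x+z⇒y-x≤z {x} {y} {z} y≤x+z = begin
    y + - x      ≤⟨ +-monoˡ-≤ (- x) y≤x+z ⟩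
    x + z + - x  ≈⟨ x+y-x≈y x z ⟩
    z            ∎

  y-x≤z⇒y≤x+z : ∀ {x y z} → y + - x ≤ z → y ≤ x + z
  y-x≤z⇒y≤x+z {x} {y} {z} y-x≤z = begin
    y              ≈⟨ x+[y-x]≈y x y ⟨
    x + (y + - x)  ≤⟨ +-monoʳ-≤ x y-x≤z ⟩
    x + z          ∎

  x≤y⇒0≤y-x : ∀ {x y} → x ≤ y → 0# ≤ y + - x
  x≤y⇒0≤y-x {x} {y} x≤y = begin
    0#       ≈⟨ -‿inverseʳ x ⟨
    x + - x  ≤⟨ +-monoˡ-≤ (- x) x≤y ⟩
    y + - x  ∎

  x≤0⇒0≤-x : ∀ {x} → x ≤ 0# → 0# ≤ - x
  x≤0⇒0≤-x {x} x≤0 = ≤-trans (x≤y⇒0≤y-x x≤0) (≤-reflexive (+-identityˡ (- x)))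

  *-monoˡ-≤ : ∀ {x y z} → 0# ≤ x → y ≤ z → x * y ≤ x * z
  *-monoˡ-≤ {x} {y} {z} 0≤x y≤z = begin
    x * y                    ≤⟨ x≤x+y (x * y) (*-nonNeg 0≤x (x≤y⇒0≤y-x y≤z)) ⟩
    x * y + x * (z + - y)    ≈⟨ distribˡ x y (z + - y) ⟨
    x * (y + (z + - y))      ≈⟨ *-congˡ (x+[y-x]≈y y z) ⟩
    x * z                    ∎

  *-monoʳ-≤ : ∀ {x y z} → 0# ≤ x → y ≤ z → y * x ≤ z * x
  *-monoʳ-≤ {x} {y} {z} 0≤x y≤z = begin
    y * x  ≈⟨ *-comm y x ⟩
    x * y  ≤⟨ *-monoˡ-≤ 0≤x y≤z ⟩
    x * z  ≈⟨ *-comm x z ⟩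
    z * x  ∎

  -- If 1 ≤ 0, then -1 is nonnegative, and so is its square, which is 1.
  0≤1 : 0# ≤ 1#
  0≤1 with ≤-total 0# 1#
  ... | inj₁ p = p
  ... | inj₂ 1≤0 = begin
    0#               ≤⟨ *-nonNeg (x≤0⇒0≤-x 1≤0) (x≤0⇒0≤-x 1≤0) ⟩
    - 1# * - 1#      ≈⟨ -‿distribˡ-* 1# (- 1#) ⟨
    - (1# * - 1#)    ≈⟨ -‿cong (*-identityˡ (- 1#)) ⟩
    - - 1#           ≈⟨ -‿involutive 1# ⟩
    1#               ∎

  -- Natural multiples of the unit and their reciprocals

  fromℕ-nonNeg : ∀ n → 0# ≤ fromℕ n
  fromℕ-nonNeg zero    = ≤-refl
  fromℕ-nonNeg (suc n) = +-nonNeg 0≤1 (fromℕ-nonNeg n)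

  fromℕ-mono-≤ : ∀ {m n} → m ℕ.≤ n → fromℕ m ≤ fromℕ n
  fromℕ-mono-≤ {n = n} z≤n = fromℕ-nonNeg n
  fromℕ-mono-≤ (s≤s m≤n)   = +-monoʳ-≤ 1# (fromℕ-mono-≤ m≤n)

  fromℕ-*-≤ : ∀ {m n o p} → m ℕ.* n ℕ.≤ o ℕ.* p → fromℕ m * fromℕ n ≤ fromℕ o * fromℕ p
  fromℕ-*-≤ {m} {n} {o} {p} mn≤op = begin
    fromℕ m * fromℕ n  ≈⟨ ×1-homo-* m n ⟨
    fromℕ (m ℕ.* n)    ≤⟨ fromℕ-mono-≤ mn≤op ⟩
    fromℕ (o ℕ.* p)    ≈⟨ ×1-homo-* o p ⟩
    fromℕ o * fromℕ p  ∎

  fromℕ-suc-* : ∀ n x → fromℕ (suc n) * x ≈ x + fromℕ n * x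
  fromℕ-suc-* n x = trans (distribʳ x 1# (fromℕ n)) (+-congʳ (*-identityˡ x))

  fromℕ-2-* : ∀ x → fromℕ 2 * x ≈ x + x
  fromℕ-2-* x = begin-equality
    fromℕ 2 * x         ≈⟨ fromℕ-suc-* 1 x ⟩
    x + fromℕ 1 * x     ≈⟨ +-congˡ (*-congʳ (+-identityʳ 1#)) ⟩
    x + 1# * x          ≈⟨ +-congˡ (*-identityˡ x) ⟩
    x + x               ∎

  -- Characteristic zero: a positive natural is at least 1 in the field. This makes `⁻¹` a genuine
  -- inverse on the denominators of `H`.
  fromℕ-suc≉0 : ∀ n → ¬ (fromℕ (suc n) ≈ 0#)
  fromℕ-suc≉0 n eq = 0≉1 (≤-antisym 0≤1 (begin
    1#             ≤⟨ x≤x+y 1# (fromℕ-nonNeg n) ⟩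
    fromℕ (suc n)  ≈⟨ eq ⟩
    0#             ∎))

  -- The index is shifted so that the denominator is never zero; `1/suc n` is 1/(n+1).
  1/suc : ℕ → Carrier
  1/suc n = fromℕ (suc n) ⁻¹

  *-1/suc : ∀ n → fromℕ (suc n) * 1/suc n ≈ 1#
  *-1/suc n = *-inverseʳ (fromℕ (suc n)) (fromℕ-suc≉0 n)

  -- A nonpositive reciprocal times n+1 would be at most 0, yet the product is 1.
  1/suc-nonNeg : ∀ n → 0# ≤ 1/suc n
  1/suc-nonNeg n with ≤-total 0# (1/suc n)
  ... | inj₁ p  = p
  ... | inj₂ ≤0 = contradiction (≤-antisym 0≤1 (begin
    1#                       ≈⟨ *-1/suc n ⟨
    fromℕ (suc n) * 1/suc n  ≤⟨ *-monoˡ-≤ (fromℕ-nonNeg (suc n)) ≤0 ⟩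
    fromℕ (suc n) * 0#       ≈⟨ zeroʳ (fromℕ (suc n)) ⟩
    0#                       ∎)) 0≉1

  suc*x≤y⇒x≤1/suc*y : ∀ n {x y} → fromℕ (suc n) * x ≤ y → x ≤ 1/suc n * y
  suc*x≤y⇒x≤1/suc*y n {x} {y} nx≤y = begin
    x                              ≈⟨ *-identityˡ x ⟨
    1# * x                         ≈⟨ *-congʳ (trans (*-comm (1/suc n) (fromℕ (suc n))) (*-1/suc n)) ⟨
    1/suc n * fromℕ (suc n) * x    ≈⟨ *-assoc (1/suc n) (fromℕ (suc n)) x ⟩
    1/suc n * (fromℕ (suc n) * x)  ≤⟨ *-monoˡ-≤ (1/suc-nonNeg n) nx≤y ⟩
    1/suc n * y                    ∎

  1/suc-anti-≤ : ∀ {m n} → m ℕ.≤ n → 1/suc n ≤ 1/suc m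
  1/suc-anti-≤ {m} {n} m≤n = begin
    1/suc n       ≤⟨ suc*x≤y⇒x≤1/suc*y m (begin
        fromℕ (suc m) * 1/suc n  ≤⟨ *-monoʳ-≤ (1/suc-nonNeg n) (fromℕ-mono-≤ (s≤s m≤n)) ⟩
        fromℕ (suc n) * 1/suc n  ≈⟨ *-1/suc n ⟩
        1#                       ∎) ⟩
    1/suc m * 1#  ≈⟨ *-identityʳ (1/suc m) ⟩
    1/suc m       ∎

  -- Finite sums and minima of lists

  sum-mono-≤ : ∀ {n} {f g : Fin n → Carrier} → (∀ i → f i ≤ g i) → sum f ≤ sum g
  sum-mono-≤ {zero}  f≤g = ≤-refl
  sum-mono-≤ {suc n} f≤g = +-mono-≤ (f≤g zero) (sum-mono-≤ (f≤g ∘ suc))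

  sum-nonNeg : ∀ {n} {f : Fin n → Carrier} → (∀ i → 0# ≤ f i) → 0# ≤ sum f
  sum-nonNeg {zero}  0≤f = ≤-refl
  sum-nonNeg {suc n} 0≤f = +-nonNeg (0≤f zero) (sum-nonNeg (0≤f ∘ suc))

  sum-nonPos : ∀ {n} {f : Fin n → Carrier} → (∀ i → f i ≤ 0#) → sum f ≤ 0#
  sum-nonPos {n} f≤0 = ≤-trans (sum-mono-≤ f≤0) (≤-reflexive (sum-replicate-zero n))

  -- Meant for sums over deleted points, where only the deletion of the point nearest to x can have
  -- a positive effect on x.
  sum-dominant-≤ : ∀ {n} {f : Fin n → Carrier} {y} j →
                   (∀ i → i ≢ j → f i ≤ 0#) → f j ≤ y → sum f ≤ y
  sum-dominant-≤ {suc n} {f} {y} zero f≤0 fj≤y = begin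
    f zero + sum (f ∘ suc)  ≤⟨ +-mono-≤ fj≤y (sum-nonPos (λ i → f≤0 (suc i) λ ())) ⟩
    y + 0#                  ≈⟨ +-identityʳ y ⟩
    y                       ∎
  sum-dominant-≤ {suc n} {f} {y} (suc j) f≤0 fj≤y = begin
    f zero + sum (f ∘ suc)  ≤⟨ +-mono-≤ (f≤0 zero λ ())
                                 (sum-dominant-≤ j (λ i i≢j → f≤0 (suc i) λ { ≡.refl → i≢j ≡.refl }) fj≤y) ⟩
    0# + y                  ≈⟨ +-identityˡ y ⟩
    y                       ∎

  sum-difference : ∀ {n} (f g : Fin n → Carrier) → sum g + sum (λ i → f i + - g i) ≈ sum f
  sum-difference f g = trans
    (sym (SumProperties.∑-distrib-+ +-commutativeMonoid g (λ i → f i + - g i)))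
    (sum-cong-≋ (λ i → x+[y-x]≈y (g i) (f i)))

  -- A sum over a subset is written as a sum over all of `Fin n` with `0#` off the subset; this
  -- counts its terms.
  sum-indicator : ∀ {n} (p : Subset n) x → sum (λ i → if lookup p i then x else 0#) ≈ fromℕ ∣ p ∣ * x
  sum-indicator []            x = sym (zeroˡ x)
  sum-indicator (outside ∷ p) x = trans (+-identityˡ _) (sum-indicator p x)
  sum-indicator (inside  ∷ p) x = trans (+-congˡ (sum-indicator p x)) (sym (fromℕ-suc-* ∣ p ∣ x))

  minimum≤ : ∀ {y ys} → y ∈ˡ ys → minimum ys ≤ y
  minimum≤ {ys = z ∷ zs} (here ≡.refl) = Extrema.min≤⊤ totalOrder z zs
  minimum≤ {ys = z ∷ zs} (there y∈zs)  = All.lookup (Extrema.min≤xs totalOrder z zs) y∈zs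

  -- The member y rules out the empty list, whose `minimum` is a dummy.
  minimum∈ : ∀ {y ys} → y ∈ˡ ys → minimum ys ∈ˡ ys
  minimum∈ {ys = z ∷ zs} _ with Extrema.argmin-sel totalOrder (λ x → x) z zs
  ... | inj₁ ≡z = here ≡z
  ... | inj₂ ∈zs = there ∈zs

  -- Harmonic numbers

  -- `sum` unfolds at its first term, so the last one has to be split off by reindexing.
  H-suc : ∀ n → H (suc n) ≈ H n + 1/suc n
  H-suc n = trans (sum-init-last {n} (λ i → 1/suc (toℕ i))) (+-cong
    (sum-cong-≋ {n} (λ i → reflexive (≡.cong 1/suc (toℕ-inject₁ i))))
    (reflexive (≡.cong 1/suc (toℕ-fromℕ n))))

  H-mono-≤ : ∀ {m n} → m ℕ.≤ n → H m ≤ H n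
  H-mono-≤ m≤n = go (ℕ.≤⇒≤′ m≤n)
    where
    go : ∀ {m n} → m ℕ.≤′ n → H m ≤ H n
    go ℕ.≤′-refl = ≤-refl
    go {m} (ℕ.≤′-step {n} m≤n) = begin
      H m            ≤⟨ go m≤n ⟩
      H n            ≤⟨ x≤x+y (H n) (1/suc-nonNeg n) ⟩
      H n + 1/suc n  ≈⟨ H-suc n ⟨
      H (suc n)      ∎

  -- The m terms after the n-th are all bounded by the first of them, 1/(n+1).
  H-+-≤ : ∀ m n → H (m ℕ.+ n) ≤ H n + fromℕ m * 1/suc n
  H-+-≤ zero n = ≤-reflexive (sym (trans (+-congˡ (zeroˡ (1/suc n))) (+-identityʳ (H n))))
  H-+-≤ (suc m) n = begin
    H (suc (m ℕ.+ n))                        ≈⟨ H-suc (m ℕ.+ n) ⟩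
    H (m ℕ.+ n) + 1/suc (m ℕ.+ n)            ≤⟨ +-mono-≤ (H-+-≤ m n) (1/suc-anti-≤ (ℕ.m≤n+m n m)) ⟩
    H n + fromℕ m * 1/suc n + 1/suc n        ≈⟨ +-assoc (H n) _ (1/suc n) ⟩
    H n + (fromℕ m * 1/suc n + 1/suc n)      ≈⟨ +-congˡ (+-comm _ (1/suc n)) ⟩
    H n + (1/suc n + fromℕ m * 1/suc n)      ≈⟨ +-congˡ (fromℕ-suc-* m (1/suc n)) ⟨
    H n + fromℕ (suc m) * 1/suc n            ∎

  -- With h = ⌊n/2⌋, at most h+1 terms follow the first h, and each is at most 1/(h+1), so together
  -- they contribute at most 1.
  H-halve : ∀ n → H n ≤ 1# + H ⌊ n /2⌋
  H-halve n = begin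
    H n                                ≡⟨ ≡.cong H (≡.trans (ℕ.+-comm ⌈ n /2⌉ ⌊ n /2⌋) (ℕ.⌊n/2⌋+⌈n/2⌉≡n n)) ⟨
    H (⌈ n /2⌉ ℕ.+ h)                  ≤⟨ H-+-≤ ⌈ n /2⌉ h ⟩
    H h + fromℕ ⌈ n /2⌉ * 1/suc h      ≤⟨ +-monoʳ-≤ (H h) (*-monoʳ-≤ (1/suc-nonNeg h) (fromℕ-mono-≤ (⌈n/2⌉≤1+⌊n/2⌋ n))) ⟩
    H h + fromℕ (suc h) * 1/suc h      ≈⟨ +-congˡ (*-1/suc h) ⟩
    H h + 1#                           ≈⟨ +-comm (H h) 1# ⟩
    1# + H h                           ∎
    where
    h = ⌊ n /2⌋
    ⌈n/2⌉≤1+⌊n/2⌋ : ∀ n → ⌈ n /2⌉ ℕ.≤ suc ⌊ n /2⌋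
    ⌈n/2⌉≤1+⌊n/2⌋ zero          = z≤n
    ⌈n/2⌉≤1+⌊n/2⌋ (suc zero)    = ℕ.≤-refl
    ⌈n/2⌉≤1+⌊n/2⌋ (suc (suc n)) = s≤s (⌈n/2⌉≤1+⌊n/2⌋ n)

  -- Strong induction: halving n costs at most 1 in `H` and lowers the floored logarithm by exactly
  -- 1 once n ≥ 2.
  H≤1+log₂ : ∀ n → H n ≤ fromℕ (suc ⌊log₂ n ⌋)
  H≤1+log₂ = <-rec (λ n → H n ≤ fromℕ (suc ⌊log₂ n ⌋)) step
    where
    step : ∀ n → (∀ {m} → m ℕ.< n → H m ≤ fromℕ (suc ⌊log₂ m ⌋)) → H n ≤ fromℕ (suc ⌊log₂ n ⌋)
    step zero _ = fromℕ-nonNeg 1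
    step (suc zero) _ = H-halve 1
    step n@(suc (suc m)) rec = begin
      H n                                 ≤⟨ H-halve n ⟩
      1# + H ⌊ n /2⌋                      ≤⟨ +-monoʳ-≤ 1# (rec (ℕ.⌊n/2⌋<n (suc m))) ⟩
      1# + fromℕ (suc ⌊log₂ ⌊ n /2⌋ ⌋)    ≡⟨ ≡.cong (λ l → 1# + fromℕ (suc l)) (⌊log₂⌊n/2⌋⌋≡⌊log₂n⌋∸1 n) ⟩
      -- The truncated subtraction is exact because n ≥ 2 forces the logarithm to be at least 1.
      1# + fromℕ (suc (⌊log₂ n ⌋ ∸ 1))    ≡⟨ ≡.cong (λ l → 1# + fromℕ l) (ℕ.m+[n∸m]≡n 1≤log) ⟩
      fromℕ (suc ⌊log₂ n ⌋)               ∎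
      where
      1≤log : 1 ℕ.≤ ⌊log₂ n ⌋
      1≤log = ℕ.≤-trans (ℕ.≤-reflexive (≡.sym (⌊log₂[2^n]⌋≡n 1))) (⌊log₂⌋-mono-≤ {2} {n} (s≤s (s≤s z≤n)))

  2*H-IsOLog : IsOLog K (λ n → fromℕ 2 * H n)
  -- From n = 2 on, the logarithm l is at least 1, so 2(1 + l) ≤ 4l; hence the constant 4 and the
  -- threshold 2.
  2*H-IsOLog = 4 , 2 , λ n 2≤n → begin
    fromℕ 2 * H n                      ≤⟨ *-monoˡ-≤ (fromℕ-nonNeg 2) (H≤1+log₂ n) ⟩
    fromℕ 2 * fromℕ (suc ⌊log₂ n ⌋)    ≤⟨ fromℕ-*-≤ {2} {suc ⌊log₂ n ⌋} {4} {⌊log₂ n ⌋} (2[1+l]≤4l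
                                            (ℕ.≤-trans (ℕ.≤-reflexive (≡.sym (⌊log₂[2^n]⌋≡n 1))) (⌊log₂⌋-mono-≤ 2≤n))) ⟩
    fromℕ 4 * fromℕ ⌊log₂ n ⌋          ∎
    where
    2[1+l]≤4l : ∀ {l} → 1 ℕ.≤ l → 2 ℕ.* suc l ℕ.≤ 4 ℕ.* l
    2[1+l]≤4l {l} 1≤l = ℕ.≤-trans
      (ℕ.*-monoʳ-≤ 2 (ℕ.+-mono-≤ 1≤l (ℕ.m≤m+n l 0)))
      (ℕ.≤-reflexive (≡.sym (ℕ.*-assoc 2 2 l)))

-- Distances to sets and costs

module ReverseGreedy {K : OrderedField c ℓ₁ ℓ₂} {n : ℕ} (X : FiniteMetricSpace K n) where
  open OrderedField K hiding (_-_; zero)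
  open OrderedFieldProperties K
  open FiniteMetricSpace X
  open IsGeneralMetric isMetric using (nonNegative; triangle; ≈⇒0) renaming (sym to dist-sym)
  open SumProperties +-commutativeMonoid using (sum-cong-≋; sum-replicate-zero; ∑-comm; ∑-distrib-+)
  open SemiringSum semiring using (*-distribˡ-sum)
  open PartialOrderReasoning (TotalOrder.poset totalOrder) hiding (start)

  distTo≤dist : ∀ x {F f} → f ∈ F → distTo X x F ≤ dist x f
  distTo≤dist x f∈F = minimum≤ (∈-map⁺ (dist x) (∈-elements⁺ f∈F))

  nearest : ∀ x {F} → Nonempty F → ∃[ f ] f ∈ F × distTo X x F ≡ dist x f
  nearest x (_ , f∈F) with ∈-map⁻ (dist x) (minimum∈ (∈-map⁺ (dist x) (∈-elements⁺ f∈F)))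
  ... | f , f∈ , eq = f , ∈-elements⁻ f∈ , eq

  distTo-anti-⊆ : ∀ x {F G} → Nonempty F → F ⊆ G → distTo X x G ≤ distTo X x F
  distTo-anti-⊆ x {F} {G} F≠∅ F⊆G with nearest x F≠∅
  ... | f , f∈F , eq = begin
    distTo X x G  ≤⟨ distTo≤dist x (F⊆G f∈F) ⟩
    dist x f      ≡⟨ eq ⟨
    distTo X x F  ∎

  distTo-nonNeg : ∀ x {F} → Nonempty F → 0# ≤ distTo X x F
  distTo-nonNeg x F≠∅ with nearest x F≠∅
  ... | f , _ , eq = ≤-trans nonNegative (≤-reflexive (reflexive (≡.sym eq)))

  cost-nonNeg : ∀ {F} → Nonempty F → 0# ≤ cost X F
  cost-nonNeg F≠∅ = sum-nonNeg (λ x → distTo-nonNeg x F≠∅)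

  cost-anti-⊆ : ∀ {F G} → Nonempty F → F ⊆ G → cost X G ≤ cost X F
  cost-anti-⊆ F≠∅ F⊆G = sum-mono-≤ (λ x → distTo-anti-⊆ x F≠∅ F⊆G)

  -- Every point serves itself at distance zero.
  cost-⊤≤0 : cost X ⊤ ≤ 0#
  cost-⊤≤0 = sum-nonPos (λ x → ≤-trans (distTo≤dist x ∈⊤) (≤-reflexive (≈⇒0 ≡.refl)))

  -- F shows that the list of k-subsets is nonempty, so the minimum is not the dummy; in use, F is
  -- the algorithm's own set `R k`.
  optimalCost-attained : ∀ {k} F → ∣ F ∣ ≡ k → ∃[ M ] ∣ M ∣ ≡ k × optimalCost X k ≡ cost X M
  optimalCost-attained {k} F ∣F∣≡k
    with ∈-map⁻ (cost X) (minimum∈ (∈-map⁺ (cost X) (∈-filter⁺ (λ F → ∣ F ∣ ℕ.≟ k) (∈-subsets F) ∣F∣≡k)))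
  ... | M , M∈ , eq = M , proj₂ (∈-filter⁻ (λ F → ∣ F ∣ ℕ.≟ k) {xs = subsets n} M∈) , eq

  -- The cost of deleting one point

  module _ {R M : Subset n} (R≠∅ : Nonempty R) (M≠∅ : Nonempty M) where

    private
      nearestIn : Fin n → Fin n
      nearestIn m = proj₁ (nearest m R≠∅)

    -- The set Q: points of R that remain available whenever a point outside Q is deleted.
    projection : Subset n
    projection = image nearestIn M

    -- Go from x to its nearest m in M, then to the point q of R nearest to m. Since q is at least
    -- as close to m as the point f of R nearest to x, the second leg is at most d(m,x) + d(x,f).
    projection-near : ∀ x → ∃[ q ] q ∈ projection × dist x q ≤ distTo X x R + fromℕ 2 * distTo X x M
    projection-near x
      with m , m∈M , d[x,M]≡ ← nearest x M≠∅
         | f , f∈R , d[x,R]≡ ← nearest x R≠∅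
      = nearestIn m , ∈-image⁺ nearestIn m∈M , (begin
      dist x (nearestIn m)                              ≤⟨ triangle x m (nearestIn m) ⟩
      dist x m + dist m (nearestIn m)                   ≡⟨ ≡.cong (dist x m +_) (proj₂ (proj₂ (nearest m R≠∅))) ⟨
      dist x m + distTo X m R                           ≤⟨ +-monoʳ-≤ (dist x m) (distTo≤dist m f∈R) ⟩
      dist x m + dist m f                               ≤⟨ +-monoʳ-≤ (dist x m) (triangle m x f) ⟩
      dist x m + (dist m x + dist x f)                  ≈⟨ +-congˡ (+-congʳ (dist-sym m x)) ⟩
      dist x m + (dist x m + dist x f)                  ≈⟨ +-assoc (dist x m) (dist x m) (dist x f) ⟨
      dist x m + dist x m + dist x f                    ≈⟨ +-comm _ (dist x f) ⟩
      dist x f + (dist x m + dist x m)                  ≈⟨ +-congˡ (fromℕ-2-* (dist x m)) ⟨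
      dist x f + fromℕ 2 * dist x m                     ≡⟨ ≡.cong₂ (λ a b → a + fromℕ 2 * b) d[x,R]≡ d[x,M]≡ ⟨
      distTo X x R + fromℕ 2 * distTo X x M             ∎)

    projection⊆R : projection ⊆ R
    projection⊆R = image-⊆ nearestIn M (λ m → proj₁ (proj₂ (nearest m R≠∅)))

    private
      S : Subset n
      S = R ─ projection

      -- Masked by `S`, so that sums over all r only count the deletions of points of R outside Q.
      increase : Fin n → Fin n → Carrier
      increase r x = if lookup S r then distTo X x (R - r) + - distTo X x R else 0#

    -- Let f be a nearest point of R to x. Deleting any other point leaves f in place; if f itself
    -- is deleted, x moves to its nearby point of Q.
    sum-increase≤ : ∀ x → sum (λ r → increase r x) ≤ fromℕ 2 * distTo X x M
    sum-increase≤ x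
      with f , f∈R , d[x,R]≡ ← nearest x R≠∅
         | q , q∈Q , d[x,q]≤ ← projection-near x
      = sum-dominant-≤ f others-≤ nearest-≤
      where
      others-≤ : ∀ r → r ≢ f → increase r x ≤ 0#
      others-≤ r r≢f with lookup S r
      ... | false = ≤-refl
      ... | true  = y≤x+z⇒y-x≤z (begin
        distTo X x (R - r)  ≤⟨ distTo≤dist x (x∈p∧x≢y⇒x∈p-y f∈R (r≢f ∘ ≡.sym)) ⟩
        dist x f            ≡⟨ d[x,R]≡ ⟨
        distTo X x R        ≈⟨ +-identityʳ _ ⟨
        distTo X x R + 0#   ∎)

      nearest-≤ : increase f x ≤ fromℕ 2 * distTo X x M
      nearest-≤ with lookup S f in S[f]≡
      ... | false = *-nonNeg (fromℕ-nonNeg 2) (distTo-nonNeg x M≠∅)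
      ... | true  = y≤x+z⇒y-x≤z (≤-trans (distTo≤dist x (x∈p∧x≢y⇒x∈p-y (projection⊆R q∈Q) q≢f)) d[x,q]≤)
        where
        -- Here f lies in `S`, outside Q, while q lies in Q; so q survives the deletion of f.
        q≢f : q ≢ f
        q≢f ≡.refl = x∈p─q⇒x∉q R projection (lookup⇒[]= f S S[f]≡) q∈Q

    -- Double counting: the increases are summed over deleted points r and clients x, then the order
    -- of summation is exchanged. For y the greedy increase will be taken.
    average-deletion : ∀ y → (∀ r → r ∈ R → y ≤ cost X (R - r) + - cost X R) →
                       fromℕ ∣ S ∣ * y ≤ fromℕ 2 * cost X M
    average-deletion y y≤ = begin
      fromℕ ∣ S ∣ * y                                ≈⟨ sum-indicator S y ⟨
      sum (λ r → if lookup S r then y else 0#)       ≤⟨ sum-mono-≤ deletion-≤ ⟩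
      sum (λ r → sum (λ x → increase r x))           ≈⟨ ∑-comm increase ⟩
      sum (λ x → sum (λ r → increase r x))           ≤⟨ sum-mono-≤ sum-increase≤ ⟩
      sum (λ x → fromℕ 2 * distTo X x M)             ≈⟨ *-distribˡ-sum (fromℕ 2) (λ x → distTo X x M) ⟨
      fromℕ 2 * cost X M                             ∎
      where
      deletion-≤ : ∀ r → (if lookup S r then y else 0#) ≤ sum (λ x → increase r x)
      deletion-≤ r with lookup S r in S[r]≡
      ... | false = ≤-reflexive (sym (sum-replicate-zero n))
      ... | true  = ≤-trans (y≤ r (p─q⊆p R projection (lookup⇒[]= r S S[r]≡))) (y≤x+z⇒y-x≤z
        (≤-reflexive (sym (sum-difference (λ x → distTo X x (R - r)) (λ x → distTo X x R)))))

    -- By minimality the greedy increase is a lower bound for every deletion, so the averaging bound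
    -- applies to it. Nonemptiness of R - r keeps the dummy distance to the empty set out of play.
    greedy-step : ∀ {r j} → GreedyChoice X R r → suc j ℕ.+ ∣ M ∣ ℕ.≤ ∣ R ∣ → Nonempty (R - r) →
                  cost X (R - r) ≤ cost X R + 1/suc j * (fromℕ 2 * cost X M)
    greedy-step {r} {j} (r∈R , minimal) j+∣M∣≤∣R∣ R-r≠∅ = y-x≤z⇒y≤x+z (suc*x≤y⇒x≤1/suc*y j (begin
      -- Replacing |S| by its lower bound j+1 requires a nonnegative increase.
      fromℕ (suc j) * Δ    ≤⟨ *-monoʳ-≤ 0≤Δ (fromℕ-mono-≤ 1+j≤∣S∣) ⟩
      fromℕ ∣ S ∣ * Δ      ≤⟨ average-deletion Δ (λ s s∈R → +-monoˡ-≤ _ (minimal s s∈R)) ⟩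
      fromℕ 2 * cost X M   ∎))
      where
      Δ = cost X (R - r) + - cost X R

      0≤Δ : 0# ≤ Δ
      0≤Δ = x≤y⇒0≤y-x (cost-anti-⊆ R-r≠∅ (p─q⊆p R ⁅ r ⁆))

      1+j≤∣S∣ : suc j ℕ.≤ ∣ S ∣
      -- |R| ≤ |S| + |Q| and |Q| ≤ |M|; then |M| cancels.
      1+j≤∣S∣ = ℕ.+-cancelʳ-≤ ∣ M ∣ (suc j) (∣ S ∣) (ℕ.≤-trans j+∣M∣≤∣R∣
        (ℕ.≤-trans (∣p∣≤∣p─q∣+∣q∣ R projection) (ℕ.+-monoʳ-≤ ∣ S ∣ (∣image∣≤∣p∣ nearestIn M))))

  -- The cost along an execution

  module _ (E : Execution X) where
    open Execution E

    -- Induction on the number i of deletions made so far, since an execution runs downwards from n.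
    ∣R[t]∣≡t : ∀ i {t} → i ℕ.+ t ≡ n → 0 ℕ.< t → ∣ R t ∣ ≡ t
    ∣R[t]∣≡t zero    ≡.refl _ = ≡.trans (≡.cong ∣_∣ start) (∣⊤∣≡n n)
    ∣R[t]∣≡t (suc i) {t} 1+i+t≡n 0<t
      with i+[1+t]≡n ← ≡.trans (ℕ.+-suc i t) 1+i+t≡n
      with r , (r∈R , _) , R[t]≡ ← step (suc t) (s≤s 0<t) (ℕ.m+n≤o⇒n≤o i (ℕ.≤-reflexive i+[1+t]≡n))
      = ℕ.suc-injective (≡.trans (≡.cong (suc ∘ ∣_∣) R[t]≡)
          (≡.trans (x∈p⇒1+∣p-x∣≡∣p∣ r∈R) (∣R[t]∣≡t i i+[1+t]≡n (s≤s z≤n))))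

    ∣R∣≡ : ∀ {t} → 0 ℕ.< t → t ℕ.≤ n → ∣ R t ∣ ≡ t
    ∣R∣≡ {t} 0<t t≤n = ∣R[t]∣≡t (n ∸ t) (ℕ.m∸n+n≡m t≤n) 0<t

    R≠∅ : ∀ {t} → 0 ℕ.< t → t ℕ.≤ n → Nonempty (R t)
    R≠∅ 0<t t≤n = 0<∣p∣⇒Nonempty (≡.subst (0 ℕ.<_) (≡.sym (∣R∣≡ 0<t t≤n)) 0<t)

    module _ {k : ℕ} {M : Subset n} (0<k : 0 ℕ.< k) (∣M∣≡k : ∣ M ∣ ≡ k) where

      cost-step : ∀ i → suc i ℕ.+ k ℕ.≤ n →
                  cost X (R (i ℕ.+ k)) ≤ cost X (R (suc i ℕ.+ k)) + 1/suc i * (fromℕ 2 * cost X M)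
      cost-step i 1+i+k≤n
        with 0<i+k ← ℕ.≤-trans 0<k (ℕ.m≤n+m k i)
        with r , choice , R[i+k]≡ ← step (suc i ℕ.+ k) (s≤s 0<i+k) 1+i+k≤n
        = begin
        cost X (R (i ℕ.+ k))              ≡⟨ ≡.cong (cost X) R[i+k]≡ ⟩
        cost X (R (suc i ℕ.+ k) - r)      ≤⟨ greedy-step (R≠∅ (s≤s z≤n) 1+i+k≤n) M≠∅ choice 1+i+∣M∣≤∣R∣
                                               (≡.subst Nonempty R[i+k]≡ (R≠∅ 0<i+k (ℕ.<⇒≤ 1+i+k≤n))) ⟩
        cost X (R (suc i ℕ.+ k)) + 1/suc i * (fromℕ 2 * cost X M)  ∎
        where
        M≠∅ : Nonempty M
        M≠∅ = 0<∣p∣⇒Nonempty (≡.subst (0 ℕ.<_) (≡.sym ∣M∣≡k) 0<k)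

        1+i+∣M∣≤∣R∣ : suc i ℕ.+ ∣ M ∣ ℕ.≤ ∣ R (suc i ℕ.+ k) ∣
        1+i+∣M∣≤∣R∣ = ℕ.≤-reflexive (≡.trans (≡.cong (suc i ℕ.+_) ∣M∣≡k) (≡.sym (∣R∣≡ (s≤s z≤n) 1+i+k≤n)))

      -- The deletion from size i+1+k to i+k is charged 1/(i+1), so the charges of the last i
      -- deletions before `R k` add up to `H i`.
      cost-steps : ∀ i → i ℕ.+ k ℕ.≤ n →
                   cost X (R k) ≤ cost X (R (i ℕ.+ k)) + H i * (fromℕ 2 * cost X M)
      cost-steps zero    _ = x≤x+y (cost X (R k)) (≤-reflexive (sym (zeroˡ _)))
      cost-steps (suc i) 1+i+k≤n = begin
        cost X (R k)                                ≤⟨ cost-steps i (ℕ.<⇒≤ 1+i+k≤n) ⟩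
        cost X (R (i ℕ.+ k)) + H i * B              ≤⟨ +-monoˡ-≤ (H i * B) (cost-step i 1+i+k≤n) ⟩
        C + 1/suc i * B + H i * B                   ≈⟨ +-assoc C (1/suc i * B) (H i * B) ⟩
        C + (1/suc i * B + H i * B)                 ≈⟨ +-congˡ (distribʳ B (1/suc i) (H i)) ⟨
        C + (1/suc i + H i) * B                     ≈⟨ +-congˡ (*-congʳ (trans (+-comm (1/suc i) (H i)) (sym (H-suc i)))) ⟩
        C + H (suc i) * B                           ∎
        where
        B = fromℕ 2 * cost X M
        C = cost X (R (suc i ℕ.+ k))

    -- With i = n - k the comparison starts from the whole space, whose cost drops out.
    cost≤2H*optimal : ∀ {k} → 0 ℕ.< k → k ℕ.≤ n →
                      cost X (R k) ≤ (fromℕ 2 * H (n ∸ k)) * optimalCost X k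
    cost≤2H*optimal {k} 0<k k≤n
      with M , ∣M∣≡k , optimal ← optimalCost-attained (R _) (∣R∣≡ 0<k k≤n)
      = begin
      cost X (R k)
        ≤⟨ cost-steps 0<k ∣M∣≡k (n ∸ k) (ℕ.≤-reflexive (ℕ.m∸n+n≡m k≤n)) ⟩
      cost X (R (n ∸ k ℕ.+ k)) + H (n ∸ k) * (fromℕ 2 * cost X M)
        ≡⟨ ≡.cong (λ F → cost X F + _) (≡.trans (≡.cong R (ℕ.m∸n+n≡m k≤n)) start) ⟩
      cost X ⊤ + H (n ∸ k) * (fromℕ 2 * cost X M)
        ≤⟨ +-monoˡ-≤ _ cost-⊤≤0 ⟩
      0# + H (n ∸ k) * (fromℕ 2 * cost X M)
        ≈⟨ +-identityˡ _ ⟩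
      H (n ∸ k) * (fromℕ 2 * cost X M)
        ≈⟨ *-assoc (H (n ∸ k)) (fromℕ 2) (cost X M) ⟨
      H (n ∸ k) * fromℕ 2 * cost X M
        ≈⟨ *-congʳ (*-comm (H (n ∸ k)) (fromℕ 2)) ⟩
      fromℕ 2 * H (n ∸ k) * cost X M
        ≡⟨ ≡.cong (fromℕ 2 * H (n ∸ k) *_) optimal ⟨
      fromℕ 2 * H (n ∸ k) * optimalCost X k ∎

    -- Allows the factor in front of the optimum to be enlarged.
    optimalCost-nonNeg : ∀ {k} → 0 ℕ.< k → k ℕ.≤ n → 0# ≤ optimalCost X k
    optimalCost-nonNeg 0<k k≤n
      with M , ≡.refl , optimal ← optimalCost-attained (R _) (∣R∣≡ 0<k k≤n)
      = ≡.subst (0# ≤_) (≡.sym optimal) (cost-nonNeg (0<∣p∣⇒Nonempty 0<k))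

-- The approximation ratio

module _ (K : OrderedField c ℓ₁ ℓ₂) where
  open OrderedField K using (_*_; fromℕ; H)
  open OrderedFieldProperties K

  -- A ratio may depend on n alone, so `H (n ∸ k)` is relaxed to `H n`.
  2*H-HasApproximationRatio : HasApproximationRatio K (λ n → fromℕ 2 * H n)
  2*H-HasApproximationRatio n X k 0<k k≤n E = ≤-trans
    (cost≤2H*optimal E 0<k k≤n)
    (*-monoʳ-≤ (optimalCost-nonNeg E 0<k k≤n) (*-monoˡ-≤ (fromℕ-nonNeg 2) (H-mono-≤ (ℕ.m∸n≤m n k))))
    where open ReverseGreedy X

mainTheorem4 : ∀ {c ℓ₁ ℓ₂ : Level} (K : OrderedField c ℓ₁ ℓ₂) →
    let open OrderedField K in
    (∀ (n : ℕ) (X : FiniteMetricSpace K n) (k : ℕ) → 1 ℕ.≤ k → k ℕ.≤ n →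
    (E : Execution X) →
    cost X (Execution.R E k) ≤ (fromℕ 2 * H (n ∸ k)) * optimalCost X k)
    × (∃[ ρ ] (HasApproximationRatio K ρ × IsOLog K ρ))
mainTheorem4 K =
    (λ n X k 1≤k k≤n E → ReverseGreedy.cost≤2H*optimal X E 1≤k k≤n)
  , (λ n → fromℕ 2 * H n) , 2*H-HasApproximationRatio K , OrderedFieldProperties.2*H-IsOLog K
  where open OrderedField K using (_*_; fromℕ; H)
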